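{- The infinite ladder graph $P_2 \square P_\infty$ satisfies $\mathrm{RED{:}IC}\%(P_2 \square P_\infty) = \tfrac{2}{3}$.
   Context: $P_\infty$ is the two-way infinite path (vertices indexed by $\mathbb{Z}$), $P_2$ the path on two vertices, and $\square$ the Cartesian product of graphs; so $P_2 \square P_\infty$ has vertices $x_i, y_i$ ($i \in \mathbb{Z}$) with edges $x_ix_{i+1}$, $y_iy_{i+1}$, $x_iy_i$. $N[v]$ denotes the closed neighborhood of $v$ and $\Delta$ symmetric difference. A set $S \subseteq V(G)$ is a redundant identifying code (RED:IC) if every vertex $v$ satisfies $|N[v] \cap S| \ge 2$ and every pair of distinct vertices $u,v$ satisfies $|(N[u]\cap S)\,\Delta\,(N[v]\cap S)| \ge 2$. The density of $S$ in an infinite graph is $\limsup_{r\to\infty} |S \cap B_r(v_0)|/|B_r(v_0)|$ for a fixed vertex $v_0$, where $B_r(v_0)$ is the set of vertices within distance $r$ of $v_0$; $\mathrm{RED{:}IC}\%(G)$ is the minimum (infimum) density of a RED:IC of $G$. -}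

module Defs where

open import Data.Bool using (Bool; true; false; if_then_else_; not)
open import Data.Bool.Properties using () renaming (_≟_ to _≟B_)
open import Data.Nat as ℕ using (ℕ; zero; suc)
open import Data.Nat.ListAction using (sum)
open import Data.Integer as ℤ using (ℤ; +_; ∣_∣)
open import Data.Rational as ℚ using (ℚ; 0ℚ)
open import Data.Product using (_×_; _,_; Σ; ∃; ∃-syntax)
open import Data.List using (List; []; _∷_; map; filter; upTo; concatMap)
open import Relation.Nullary using (¬_; Dec; yes; no)
open import Relation.Binary.PropositionalEquality using (_≡_)

-- Vertices of the ladder P₂ □ P∞: (false , i) is x_i, (true , i) is y_i.
Vertex : Set
Vertex = Bool × ℤ

-- Graph distance in P₂ □ P∞ (distance in a Cartesian product is the sum
-- of the distances in the factors): |i - j| + [sides differ].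
dist : Vertex → Vertex → ℕ
dist (b , i) (c , j) = ∣ i ℤ.- j ∣ ℕ.+ (if does (b ≟B c) then 0 else 1)
  where open import Relation.Nullary using (does)

Adjacent : Vertex → Vertex → Set
Adjacent u v = dist u v ≡ 1

-- Explicit list of the (four distinct) elements of N[v].
Nlist : Vertex → List Vertex
Nlist (b , i) = (b , i) ∷ (b , i ℤ.+ + 1) ∷ (b , i ℤ.- + 1) ∷ (not b , i) ∷ []

Subset : Set
Subset = Vertex → Bool

count : Subset → List Vertex → ℕ
count S l = sum (map (λ w → if S w then 1 else 0) l)

nbhdCount : Subset → Vertex → ℕ
nbhdCount S v = count S (Nlist v)

-- |(N[u] ∩ S) Δ (N[v] ∩ S)| : elements of S in N[u] but not N[v], plus
-- elements of S in N[v] but not N[u]  (w ∈ N[v] iff dist v w ≤ 1).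
symDiffCount : Subset → Vertex → Vertex → ℕ
symDiffCount S u v =
  count S (filter (λ w → ¬? (dist v w ℕ.≤? 1)) (Nlist u)) ℕ.+
  count S (filter (λ w → ¬? (dist u w ℕ.≤? 1)) (Nlist v))
  where open import Relation.Nullary.Decidable using (¬?)

IsREDIC : Subset → Set
IsREDIC S =
  (∀ v → 2 ℕ.≤ nbhdCount S v) ×
  (∀ u v → ¬ (u ≡ v) → 2 ℕ.≤ symDiffCount S u v)

-- The ball B_r(v₀) as a list (without repetitions): all vertices (b , i₀ + k)
-- with -r ≤ k ≤ r, b ∈ {x,y}, at distance ≤ r from v₀.
ball : Vertex → ℕ → List Vertex
ball (b₀ , i₀) r =
  filter (λ w → dist (b₀ , i₀) w ℕ.≤? r)
    (concatMap (λ k → (false , i₀ ℤ.+ + k ℤ.- + r) ∷ (true , i₀ ℤ.+ + k ℤ.- + r) ∷ [])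
               (upTo (suc (r ℕ.+ r))))

ballSize : Vertex → ℕ → ℕ
ballSize v r = Data.List.length (ball v r)
  where import Data.List

-- ratio |S ∩ B_r(v₀)| / |B_r(v₀)| compared with c, cross-multiplied
-- (|B_r(v₀)| ≥ 1 always).
-- limsup_{r→∞} |S ∩ B_r| / |B_r| ≥ c :
DensityGE : Subset → Vertex → ℚ → Set
DensityGE S v₀ c =
  ∀ (ε : ℚ) → 0ℚ ℚ.< ε → ∀ (R : ℕ) → ∃[ r ] (R ℕ.≤ r ×
    (c ℚ.- ε) ℚ.* (+ ballSize v₀ r ℚ./ 1) ℚ.< (+ count S (ball v₀ r) ℚ./ 1))

-- limsup_{r→∞} |S ∩ B_r| / |B_r| ≤ c :
DensityLE : Subset → Vertex → ℚ → Set
DensityLE S v₀ c =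
  ∀ (ε : ℚ) → 0ℚ ℚ.< ε → ∃[ R ] (∀ (r : ℕ) → R ℕ.≤ r →
    (+ count S (ball v₀ r) ℚ./ 1) ℚ.≤ (c ℚ.+ ε) ℚ.* (+ ballSize v₀ r ℚ./ 1))

-- RED:IC%(P₂ □ P∞) = c  (infimum of densities of RED:ICs, densities taken
-- w.r.t. base vertex v₀):
--   every RED:IC has density ≥ c, and for every ε > 0 some RED:IC has
--   density ≤ c + ε.
REDICdensityIs : Vertex → ℚ → Set
REDICdensityIs v₀ c =
  (∀ S → IsREDIC S → DensityGE S v₀ c) ×
  (∀ (ε : ℚ) → 0ℚ ℚ.< ε → ∃[ S ] (IsREDIC S × DensityLE S v₀ (c ℚ.+ ε)))

module Submission where

-- Lower bound: in a RED:IC every three consecutive columns of the ladder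
-- contain at least four code vertices.  The conditions at columns 0, 1, 2
-- only involve the ten vertices of columns -1, …, 3, so this is a finite
-- check, transported to every position by translation.  A ball of radius r
-- is made of 2r + 1 columns, all but the two outer ones complete, so it
-- holds at least (2/3)·|B_r| - O(1) code vertices.
--
-- Upper bound: both vertices of every column whose index is not a multiple
-- of 3 form a RED:IC (by periodicity again a finite check), with exactly
-- four vertices in every three consecutive columns, hence of density 2/3.

open import Defs
open import Data.Bool using (Bool; true; false; if_then_else_; not; T)
open import Data.Bool.Properties using () renaming (_≟_ to _≟ᵇ_)
open import Data.Empty using (⊥-elim)
open import Data.Fin.Subset.Properties using (anySubset?)
open import Data.Integer as ℤ using (ℤ; +_; -[1+_]; -_; ∣_∣; _⊖_)
import Data.Integer.Properties as ℤ
import Data.Integer.Tactic.RingSolver as ℤ-Solver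
open import Data.List using (List; []; _∷_; _++_; map; filter; concatMap; applyUpTo; length)
open import Data.List.Properties using (map-∘; map-cong; map-++; filter-++; filter-all)
open import Data.List.Relation.Unary.All using (All; []; _∷_; all?)
open import Data.Nat as ℕ using (ℕ; zero; suc; _+_; _*_; _≤_; _<_; _≤ᵇ_; _≤?_; _<?_; z≤n; s≤s; z<s; s<s)
open import Data.Nat.ListAction using (sum)
open import Data.Nat.ListAction.Properties using (sum-++)
open import Data.Nat.Properties
import Data.Nat.Tactic.RingSolver as ℕ-Solver
open import Data.Product using (_×_; _,_; proj₁; proj₂; ∃; ∃-syntax)
open import Data.Rational as ℚ using (mkℚ; 0ℚ; _/_; toℚᵘ)
import Data.Rational.Properties as ℚ
open import Data.Rational.Unnormalised as ℚᵘ using (mkℚᵘ; *≤*; *<*)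
import Data.Rational.Unnormalised.Properties as ℚᵘ
open import Data.Sum using (inj₁; inj₂)
open import Data.Unit using (tt)
open import Data.Vec using (Vec; []; _∷_)
open import Function using (_∘_; id)
open import Relation.Nullary using (¬_; does)
open import Relation.Nullary.Decidable using (¬?; _×-dec_; toWitnessFalse)
open import Relation.Unary using (Pred; Decidable)
open import Relation.Binary.PropositionalEquality

-- Translations

shift : ℤ → Vertex → Vertex
shift j (b , i) = b , i ℤ.+ j

shift-shift-neg : ∀ j v → shift j (shift (- j) v) ≡ v
shift-shift-neg j (b , i) = cong (b ,_) (i-j+j≡i i j)
  where
  i-j+j≡i : ∀ i j → i ℤ.+ - j ℤ.+ j ≡ i
  i-j+j≡i = ℤ-Solver.solve-∀

shift-neg-shift : ∀ j v → shift (- j) (shift j v) ≡ v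
shift-neg-shift j (b , i) = cong (b ,_) (i+j-j≡i i j)
  where
  i+j-j≡i : ∀ i j → i ℤ.+ j ℤ.+ - j ≡ i
  i+j-j≡i = ℤ-Solver.solve-∀

shift-injective : ∀ j {u v} → shift j u ≡ shift j v → u ≡ v
shift-injective j {u} {v} eq =
  trans (sym (shift-neg-shift j u)) (trans (cong (shift (- j)) eq) (shift-neg-shift j v))

dist-shift : ∀ j u v → dist (shift j u) (shift j v) ≡ dist u v
dist-shift j (b , i) (c , k) = cong (λ z → ∣ z ∣ + _) (difference-invariant i j k)
  where
  difference-invariant : ∀ i j k → (i ℤ.+ j) ℤ.- (k ℤ.+ j) ≡ i ℤ.- k
  difference-invariant = ℤ-Solver.solve-∀

Nlist-shift : ∀ j v → Nlist (shift j v) ≡ map (shift j) (Nlist v)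
Nlist-shift j (b , i) =
  cong₂ (λ right left → (b , i ℤ.+ j) ∷ (b , right) ∷ (b , left) ∷ (not b , i ℤ.+ j) ∷ [])
        (right-neighbour i j) (left-neighbour i j)
  where
  right-neighbour : ∀ i j → i ℤ.+ j ℤ.+ + 1 ≡ i ℤ.+ + 1 ℤ.+ j
  right-neighbour = ℤ-Solver.solve-∀
  left-neighbour : ∀ i j → i ℤ.+ j ℤ.- + 1 ≡ i ℤ.- + 1 ℤ.+ j
  left-neighbour = ℤ-Solver.solve-∀

count-map : ∀ S (f : Vertex → Vertex) l → count S (map f l) ≡ count (S ∘ f) l
count-map S f l = cong sum (sym (map-∘ l))

count-cong : ∀ {S S′} → (∀ w → S w ≡ S′ w) → ∀ l → count S l ≡ count S′ l
count-cong S≗S′ l = cong sum (map-cong (λ w → cong (λ b → if b then 1 else 0) (S≗S′ w)) l)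

nbhdCount-shift : ∀ S j v → nbhdCount S (shift j v) ≡ nbhdCount (S ∘ shift j) v
nbhdCount-shift S j v = trans (cong (count S) (Nlist-shift j v)) (count-map S (shift j) (Nlist v))

awayFrom : Vertex → List Vertex → List Vertex
awayFrom v = filter (λ w → ¬? (dist v w ≤? 1))

count-awayFrom-shift : ∀ S j v l → count S (awayFrom (shift j v) (map (shift j) l)) ≡ count (S ∘ shift j) (awayFrom v l)
count-awayFrom-shift S j v [] = refl
count-awayFrom-shift S j v (w ∷ l) rewrite dist-shift j v w with dist v w ≤ᵇ 1
... | true = count-awayFrom-shift S j v l
... | false = cong (_ ℕ.+_) (count-awayFrom-shift S j v l)

symDiffCount-shift : ∀ S j u v → symDiffCount S (shift j u) (shift j v) ≡ symDiffCount (S ∘ shift j) u v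
symDiffCount-shift S j u v = cong₂ _+_ (awayFrom-shift v u) (awayFrom-shift u v)
  where
  awayFrom-shift : ∀ v u → count S (awayFrom (shift j v) (Nlist (shift j u))) ≡ count (S ∘ shift j) (awayFrom v (Nlist u))
  awayFrom-shift v u = trans (cong (count S ∘ awayFrom (shift j v)) (Nlist-shift j u))
                             (count-awayFrom-shift S j v (Nlist u))

IsREDIC-shift : ∀ S j → IsREDIC S → IsREDIC (S ∘ shift j)
IsREDIC-shift S j (dominating , separating) =
  (λ v → subst (2 ≤_) (nbhdCount-shift S j v) (dominating (shift j v))) ,
  (λ u v u≢v → subst (2 ≤_) (symDiffCount-shift S j u v)
                 (separating (shift j u) (shift j v) (u≢v ∘ shift-injective j)))

-- Periodic subsets

Periodic : ℤ → Subset → Set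
Periodic p S = ∀ w → S (shift p w) ≡ S w

Periodic-neg : ∀ {p S} → Periodic p S → Periodic (- p) S
Periodic-neg {p} {S} periodic w = trans (sym (periodic (shift (- p) w))) (cong S (shift-shift-neg p w))

nbhdCount-periodic : ∀ {p S} → Periodic p S → ∀ v → nbhdCount S (shift p v) ≡ nbhdCount S v
nbhdCount-periodic {p} {S} periodic v = trans (nbhdCount-shift S p v) (count-cong periodic (Nlist v))

symDiffCount-periodic : ∀ {p S} → Periodic p S → ∀ u v → symDiffCount S (shift p u) (shift p v) ≡ symDiffCount S u v
symDiffCount-periodic {p} {S} periodic u v =
  trans (symDiffCount-shift S p u v)
        (cong₂ _+_ (count-cong periodic (awayFrom v (Nlist u))) (count-cong periodic (awayFrom u (Nlist v))))

Dominated : Subset → Vertex → Set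
Dominated S v = 2 ≤ nbhdCount S v

Separated : Subset → Vertex → Set
Separated S u = ∀ v → ¬ u ≡ v → 2 ≤ symDiffCount S u v

Dominated-periodic : ∀ {p S} → Periodic p S → ∀ v → Dominated S (shift p v) → Dominated S v
Dominated-periodic periodic v = subst (2 ≤_) (nbhdCount-periodic periodic v)

Separated-periodic : ∀ {p S} → Periodic p S → ∀ u → Separated S (shift p u) → Separated S u
Separated-periodic {p} periodic u separated v u≢v =
  subst (2 ≤_) (symDiffCount-periodic periodic u v) (separated (shift p v) (u≢v ∘ shift-injective p))

mod₃-induction : (Q : ℤ → Set) → (∀ i → Q (i ℤ.+ + 3) → Q i) → (∀ i → Q (i ℤ.- + 3) → Q i) →
                 Q (+ 0) → Q (+ 1) → Q (+ 2) → ∀ i → Q i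
mod₃-induction Q down up q₀ q₁ q₂ = go
  where
  go : ∀ i → Q i
  go (+ 0) = q₀
  go (+ 1) = q₁
  go (+ 2) = q₂
  go (+ suc (suc (suc n))) = up _ (go (+ n))
  go -[1+ 0 ] = down _ q₂
  go -[1+ 1 ] = down _ q₁
  go -[1+ 2 ] = down _ q₀
  go -[1+ suc (suc (suc n)) ] = down _ (go -[1+ n ])

Periodic₃-induction : ∀ {S} → Periodic (+ 3) S → (Q : ℤ → Set) → (∀ {p} → Periodic p S → ∀ i → Q (i ℤ.+ p) → Q i) →
                      Q (+ 0) → Q (+ 1) → Q (+ 2) → ∀ i → Q i
Periodic₃-induction periodic Q transfer = mod₃-induction Q (transfer periodic) (transfer (Periodic-neg periodic))

column : ℤ → List Vertex
column i = (false , i) ∷ (true , i) ∷ []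

columnWeight : Subset → ℤ → ℕ
columnWeight S i = count S (column i)

windowWeight : Subset → ℤ → ℕ
windowWeight S i = columnWeight S (+ 0 ℤ.+ i) + columnWeight S (+ 1 ℤ.+ i) + columnWeight S (+ 2 ℤ.+ i)

columnWeight-periodic : ∀ {p S} → Periodic p S → ∀ i → columnWeight S (i ℤ.+ p) ≡ columnWeight S i
columnWeight-periodic periodic i = count-cong periodic (column i)

windowWeight-periodic : ∀ {p S} → Periodic p S → ∀ i → windowWeight S (i ℤ.+ p) ≡ windowWeight S i
windowWeight-periodic {p} {S} periodic i =
  cong₂ _+_ (cong₂ _+_ (shifted (+ 0)) (shifted (+ 1))) (shifted (+ 2))
  where
  shifted : ∀ t → columnWeight S (t ℤ.+ (i ℤ.+ p)) ≡ columnWeight S (t ℤ.+ i)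
  shifted t = trans (cong (columnWeight S) (sym (ℤ.+-assoc t i p))) (columnWeight-periodic periodic (t ℤ.+ i))

localConditions : Subset → List ℕ
localConditions S =
  nbhdCount S (false , + 0) ∷ nbhdCount S (false , + 1) ∷ nbhdCount S (false , + 2) ∷
  nbhdCount S (true , + 0) ∷ nbhdCount S (true , + 1) ∷ nbhdCount S (true , + 2) ∷
  symDiffCount S (false , + 1) (true , + 1) ∷
  symDiffCount S (false , + 0) (false , + 1) ∷ symDiffCount S (false , + 1) (false , + 2) ∷
  symDiffCount S (true , + 0) (true , + 1) ∷ symDiffCount S (true , + 1) (true , + 2) ∷ []

localConditions-hold : ∀ S → IsREDIC S → All (2 ≤_) (localConditions S)
localConditions-hold S (dominating , separating) =
  dominating _ ∷ dominating _ ∷ dominating _ ∷ dominating _ ∷ dominating _ ∷ dominating _ ∷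
  separating (false , + 1) (true , + 1) (λ ()) ∷
  separating (false , + 0) (false , + 1) (λ ()) ∷ separating (false , + 1) (false , + 2) (λ ()) ∷
  separating (true , + 0) (true , + 1) (λ ()) ∷ separating (true , + 1) (true , + 2) (λ ()) ∷ []

restrict : Subset → Vec Bool 10
restrict S =
  S (false , -[1+ 0 ]) ∷ S (false , + 0) ∷ S (false , + 1) ∷ S (false , + 2) ∷ S (false , + 3) ∷
  S (true , -[1+ 0 ]) ∷ S (true , + 0) ∷ S (true , + 1) ∷ S (true , + 2) ∷ S (true , + 3) ∷ []

extend : Vec Bool 10 → Subset
extend (s ∷ _) (false , -[1+ 0 ]) = s
extend (_ ∷ s ∷ _) (false , + 0) = s
extend (_ ∷ _ ∷ s ∷ _) (false , + 1) = s
extend (_ ∷ _ ∷ _ ∷ s ∷ _) (false , + 2) = s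
extend (_ ∷ _ ∷ _ ∷ _ ∷ s ∷ _) (false , + 3) = s
extend (_ ∷ _ ∷ _ ∷ _ ∷ _ ∷ s ∷ _) (true , -[1+ 0 ]) = s
extend (_ ∷ _ ∷ _ ∷ _ ∷ _ ∷ _ ∷ s ∷ _) (true , + 0) = s
extend (_ ∷ _ ∷ _ ∷ _ ∷ _ ∷ _ ∷ _ ∷ s ∷ _) (true , + 1) = s
extend (_ ∷ _ ∷ _ ∷ _ ∷ _ ∷ _ ∷ _ ∷ _ ∷ s ∷ _) (true , + 2) = s
extend (_ ∷ _ ∷ _ ∷ _ ∷ _ ∷ _ ∷ _ ∷ _ ∷ _ ∷ s ∷ _) (true , + 3) = s
extend _ _ = false

LocalCounterexample : Vec Bool 10 → Set
LocalCounterexample s = All (2 ≤_) (localConditions (extend s)) × windowWeight (extend s) (+ 0) < 4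

no-LocalCounterexample : ¬ ∃ LocalCounterexample
no-LocalCounterexample = toWitnessFalse
  {a? = anySubset? (λ s → all? (2 ≤?_) (localConditions (extend s)) ×-dec windowWeight (extend s) (+ 0) <? 4)} _

-- localConditions and windowWeight at 0 inspect S only on columns -1, …, 3,
-- where extend (restrict S) agrees with S definitionally.
IsREDIC-windowWeight₀ : ∀ S → IsREDIC S → 4 ≤ windowWeight S (+ 0)
IsREDIC-windowWeight₀ S redic =
  ≮⇒≥ (λ light → no-LocalCounterexample (restrict S , localConditions-hold S redic , light))

IsREDIC-windowWeight : ∀ S → IsREDIC S → ∀ i → 4 ≤ windowWeight S i
IsREDIC-windowWeight S redic i = IsREDIC-windowWeight₀ (S ∘ shift i) (IsREDIC-shift S i redic)

-- The periodic code

3∤ : ℕ → Bool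
3∤ 0 = false
3∤ 1 = true
3∤ 2 = true
3∤ (suc (suc (suc n))) = 3∤ n

ladderCode : Subset
ladderCode (_ , i) = 3∤ ∣ i ∣

ladderCode-periodic : Periodic (+ 3) ladderCode
ladderCode-periodic (b , + n) = cong 3∤ (+-comm n 3)
ladderCode-periodic (b , -[1+ 0 ]) = refl
ladderCode-periodic (b , -[1+ 1 ]) = refl
ladderCode-periodic (b , -[1+ 2 ]) = refl
ladderCode-periodic (b , -[1+ suc (suc (suc n)) ]) = refl

ladderCode-windowWeight : ∀ i → windowWeight ladderCode i ≡ 4
ladderCode-windowWeight = Periodic₃-induction ladderCode-periodic (λ i → windowWeight ladderCode i ≡ 4)
  (λ periodic i weight≡4 → trans (sym (windowWeight-periodic periodic i)) weight≡4) refl refl refl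

by-evaluation : ∀ {n} → T (2 ≤ᵇ n) → 2 ≤ n
by-evaluation = ≤ᵇ⇒≤ 2 _

separatedᵇ : Vertex → Vertex → Bool
separatedᵇ u v = 2 ≤ᵇ symDiffCount ladderCode u v

columns-separated : ∀ i j
  {_ : T (separatedᵇ (false , i) (false , j)) × T (separatedᵇ (false , i) (true , j)) ×
       T (separatedᵇ (true , i) (false , j)) × T (separatedᵇ (true , i) (true , j))} →
  ∀ b c → 2 ≤ symDiffCount ladderCode (b , i) (c , j)
columns-separated i j {p , _ , _ , _} false false = by-evaluation p
columns-separated i j {_ , p , _ , _} false true = by-evaluation p
columns-separated i j {_ , _ , p , _} true false = by-evaluation p
columns-separated i j {_ , _ , _ , p} true true = by-evaluation p

-- In the first and last clause of each of the following, v is three or more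
-- columns away from u, so no vertex of N[u] is within distance 1 of v and
-- the first summand of symDiffCount evaluates to |N[u] ∩ ladderCode| = 2.
ladderCode-separated₀ : ∀ b → Separated ladderCode (b , + 0)
ladderCode-separated₀ b (c , -[1+ suc (suc n) ]) _ = m≤m+n 2 _
ladderCode-separated₀ b (c , -[1+ 1 ]) _ = columns-separated (+ 0) -[1+ 1 ] b c
ladderCode-separated₀ b (c , -[1+ 0 ]) _ = columns-separated (+ 0) -[1+ 0 ] b c
ladderCode-separated₀ false (false , + 0) u≢v = ⊥-elim (u≢v refl)
ladderCode-separated₀ false (true , + 0) _ = by-evaluation tt
ladderCode-separated₀ true (false , + 0) _ = by-evaluation tt
ladderCode-separated₀ true (true , + 0) u≢v = ⊥-elim (u≢v refl)
ladderCode-separated₀ b (c , + 1) _ = columns-separated (+ 0) (+ 1) b c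
ladderCode-separated₀ b (c , + 2) _ = columns-separated (+ 0) (+ 2) b c
ladderCode-separated₀ b (c , + suc (suc (suc n))) _ = m≤m+n 2 _

ladderCode-separated₁ : ∀ b → Separated ladderCode (b , + 1)
ladderCode-separated₁ b (c , -[1+ suc n ]) _ = m≤m+n 2 _
ladderCode-separated₁ b (c , -[1+ 0 ]) _ = columns-separated (+ 1) -[1+ 0 ] b c
ladderCode-separated₁ b (c , + 0) _ = columns-separated (+ 1) (+ 0) b c
ladderCode-separated₁ false (false , + 1) u≢v = ⊥-elim (u≢v refl)
ladderCode-separated₁ false (true , + 1) _ = by-evaluation tt
ladderCode-separated₁ true (false , + 1) _ = by-evaluation tt
ladderCode-separated₁ true (true , + 1) u≢v = ⊥-elim (u≢v refl)
ladderCode-separated₁ b (c , + 2) _ = columns-separated (+ 1) (+ 2) b c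
ladderCode-separated₁ b (c , + 3) _ = columns-separated (+ 1) (+ 3) b c
ladderCode-separated₁ b (c , + suc (suc (suc (suc n)))) _ = m≤m+n 2 _

ladderCode-separated₂ : ∀ b → Separated ladderCode (b , + 2)
ladderCode-separated₂ b (c , -[1+ n ]) _ = m≤m+n 2 _
ladderCode-separated₂ b (c , + 0) _ = columns-separated (+ 2) (+ 0) b c
ladderCode-separated₂ b (c , + 1) _ = columns-separated (+ 2) (+ 1) b c
ladderCode-separated₂ false (false , + 2) u≢v = ⊥-elim (u≢v refl)
ladderCode-separated₂ false (true , + 2) _ = by-evaluation tt
ladderCode-separated₂ true (false , + 2) _ = by-evaluation tt
ladderCode-separated₂ true (true , + 2) u≢v = ⊥-elim (u≢v refl)
ladderCode-separated₂ b (c , + 3) _ = columns-separated (+ 2) (+ 3) b c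
ladderCode-separated₂ b (c , + 4) _ = columns-separated (+ 2) (+ 4) b c
ladderCode-separated₂ b (c , + suc (suc (suc (suc (suc n))))) _ = m≤m+n 2 _

ladderCode-IsREDIC : IsREDIC ladderCode
ladderCode-IsREDIC = (λ (b , i) → dominated i b) , (λ (b , i) → separated i b)
  where
  dominated : ∀ i b → Dominated ladderCode (b , i)
  dominated = Periodic₃-induction ladderCode-periodic (λ i → ∀ b → Dominated ladderCode (b , i))
    (λ periodic i dominated b → Dominated-periodic periodic (b , i) (dominated b))
    (λ _ → by-evaluation tt) (λ _ → by-evaluation tt) (λ _ → by-evaluation tt)
  separated : ∀ i b → Separated ladderCode (b , i)
  separated = Periodic₃-induction ladderCode-periodic (λ i → ∀ b → Separated ladderCode (b , i))
    (λ periodic i separated b → Separated-periodic periodic (b , i) (separated b))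
    ladderCode-separated₀ ladderCode-separated₁ ladderCode-separated₂

∑< : ℕ → (ℕ → ℕ) → ℕ
∑< n f = sum (applyUpTo f n)

∑<-mono-≤ : ∀ {f g} n → (∀ k → k < n → f k ≤ g k) → ∑< n f ≤ ∑< n g
∑<-mono-≤ zero _ = z≤n
∑<-mono-≤ (suc n) f≤g = +-mono-≤ (f≤g 0 z<s) (∑<-mono-≤ n (λ k k<n → f≤g (suc k) (s<s k<n)))

∑<-monoˡ-≤ : ∀ f {m n} → m ≤ n → ∑< m f ≤ ∑< n f
∑<-monoˡ-≤ f z≤n = z≤n
∑<-monoˡ-≤ f (s≤s m≤n) = +-monoʳ-≤ (f 0) (∑<-monoˡ-≤ (f ∘ suc) m≤n)

∑<-const : ∀ n c → ∑< n (λ _ → c) ≡ n * c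
∑<-const zero c = refl
∑<-const (suc n) c = cong (c ℕ.+_) (∑<-const n c)

Σ₃ : (ℕ → ℕ) → ℕ → ℕ
Σ₃ f k = f k + f (1 + k) + f (2 + k)

private
  ∑<-split₃ : ∀ f n → ∑< (3 + n) f ≡ Σ₃ f 0 + ∑< n (f ∘ suc ∘ suc ∘ suc)
  ∑<-split₃ f n = sym (+-assoc₃ (f 0) (f 1) (f 2) (∑< n (f ∘ suc ∘ suc ∘ suc)))
    where
    +-assoc₃ : ∀ a b c x → a + b + c + x ≡ a + (b + (c + x))
    +-assoc₃ = ℕ-Solver.solve-∀

  ∑<-prefix : ∀ f {n} → n ≤ 3 → ∑< n f ≤ Σ₃ f 0
  ∑<-prefix f n≤3 = ≤-trans (∑<-monoˡ-≤ f n≤3)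
    (≤-reflexive (trans (sym (+-assoc (f 0) (f 1) (f 2 + 0))) (cong (f 0 + f 1 ℕ.+_) (+-identityʳ (f 2)))))

  nw≤3s+2w : ∀ {w s} n → n ≤ 2 → n * w ≤ 3 * s + 2 * w
  nw≤3s+2w {w} {s} n n≤2 = ≤-trans (*-monoˡ-≤ w n≤2) (m≤n+m (2 * w) (3 * s))

  3w≤nw+2w : ∀ {w} n → 1 ≤ n → 3 * w ≤ n * w + 2 * w
  3w≤nw+2w {w} n 1≤n = ≤-trans (≤-reflexive (*-distribʳ-+ w 1 2)) (+-monoˡ-≤ (2 * w) (*-monoˡ-≤ w 1≤n))

∑<-Σ₃-lower : ∀ {w} f → (∀ k → w ≤ Σ₃ f k) → ∀ n → n * w ≤ 3 * ∑< n f + 2 * w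
∑<-Σ₃-lower {w} f heavy (suc (suc (suc n))) = begin
  (3 + n) * w                           ≡⟨ *-distribʳ-+ w 3 n ⟩
  3 * w + n * w                         ≤⟨ +-mono-≤ (*-monoʳ-≤ 3 (heavy 0)) (∑<-Σ₃-lower f′ (heavy ∘ (3 ℕ.+_)) n) ⟩
  3 * Σ₃ f 0 + (3 * ∑< n f′ + 2 * w)   ≡⟨ +-assoc (3 * Σ₃ f 0) (3 * ∑< n f′) (2 * w) ⟨
  3 * Σ₃ f 0 + 3 * ∑< n f′ + 2 * w     ≡⟨ cong (_+ 2 * w) (*-distribˡ-+ 3 (Σ₃ f 0) (∑< n f′)) ⟨
  3 * (Σ₃ f 0 + ∑< n f′) + 2 * w       ≡⟨ cong (λ s → 3 * s + 2 * w) (∑<-split₃ f n) ⟨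
  3 * ∑< (3 + n) f + 2 * w ∎
  where
  open ≤-Reasoning
  f′ = f ∘ suc ∘ suc ∘ suc
∑<-Σ₃-lower f _ 0 = z≤n
∑<-Σ₃-lower {w} f _ 1 = nw≤3s+2w {w} {∑< 1 f} 1 (s≤s z≤n)
∑<-Σ₃-lower {w} f _ 2 = nw≤3s+2w {w} {∑< 2 f} 2 (s≤s (s≤s z≤n))

∑<-Σ₃-upper : ∀ {w} f → (∀ k → Σ₃ f k ≤ w) → ∀ n → 3 * ∑< n f ≤ n * w + 2 * w
∑<-Σ₃-upper {w} f light (suc (suc (suc n))) = begin
  3 * ∑< (3 + n) f                      ≡⟨ cong (3 *_) (∑<-split₃ f n) ⟩
  3 * (Σ₃ f 0 + ∑< n f′)               ≡⟨ *-distribˡ-+ 3 (Σ₃ f 0) (∑< n f′) ⟩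
  3 * Σ₃ f 0 + 3 * ∑< n f′             ≤⟨ +-mono-≤ (*-monoʳ-≤ 3 (light 0)) (∑<-Σ₃-upper f′ (light ∘ (3 ℕ.+_)) n) ⟩
  3 * w + (n * w + 2 * w)               ≡⟨ +-assoc (3 * w) (n * w) (2 * w) ⟨
  3 * w + n * w + 2 * w                 ≡⟨ cong (_+ 2 * w) (*-distribʳ-+ w 3 n) ⟨
  (3 + n) * w + 2 * w ∎
  where
  open ≤-Reasoning
  f′ = f ∘ suc ∘ suc ∘ suc
∑<-Σ₃-upper f _ 0 = z≤n
∑<-Σ₃-upper {w} f light 1 = ≤-trans (*-monoʳ-≤ 3 (≤-trans (∑<-prefix f (s≤s z≤n)) (light 0))) (3w≤nw+2w {w} 1 (s≤s z≤n))
∑<-Σ₃-upper {w} f light 2 = ≤-trans (*-monoʳ-≤ 3 (≤-trans (∑<-prefix f (s≤s (s≤s z≤n))) (light 0))) (3w≤nw+2w {w} 2 (s≤s z≤n))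

-- Counting in balls

count-++ : ∀ S xs ys → count S (xs ++ ys) ≡ count S xs + count S ys
count-++ S xs ys = trans (cong sum (map-++ _ xs ys)) (sum-++ (map _ xs) (map _ ys))

count-filter-≤ : ∀ S {p} {P : Pred Vertex p} (P? : Decidable P) l → count S (filter P? l) ≤ count S l
count-filter-≤ S P? [] = z≤n
count-filter-≤ S P? (w ∷ l) with does (P? w)
... | true = +-monoʳ-≤ (if S w then 1 else 0) (count-filter-≤ S P? l)
... | false = ≤-trans (count-filter-≤ S P? l) (m≤n+m _ _)

count-filter-concatMap : ∀ S {p} {P : Pred Vertex p} (P? : Decidable P) (g : ℕ → List Vertex) f n →
  count S (filter P? (concatMap g (applyUpTo f n))) ≡ ∑< n (λ k → count S (filter P? (g (f k))))
count-filter-concatMap S P? g f zero = refl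
count-filter-concatMap S P? g f (suc n) = begin
  count S (filter P? (g (f 0) ++ rest))                    ≡⟨ cong (count S) (filter-++ P? (g (f 0)) rest) ⟩
  count S (filter P? (g (f 0)) ++ filter P? rest)          ≡⟨ count-++ S (filter P? (g (f 0))) (filter P? rest) ⟩
  count S (filter P? (g (f 0))) + count S (filter P? rest) ≡⟨ cong (count S (filter P? (g (f 0))) ℕ.+_)
                                                                   (count-filter-concatMap S P? g (f ∘ suc) n) ⟩
  ∑< (suc n) (λ k → count S (filter P? (g (f k)))) ∎
  where
  open ≡-Reasoning
  rest = concatMap g (applyUpTo (f ∘ suc) n)

length≡count-all : ∀ l → length l ≡ count (λ _ → true) l
length≡count-all [] = refl
length≡count-all (_ ∷ l) = cong suc (length≡count-all l)

ballColumn : ℤ → ℕ → ℕ → ℤ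
ballColumn i₀ r k = i₀ ℤ.+ + k ℤ.- + r

ballColumn-+ : ∀ i₀ r t k → ballColumn i₀ r (t + k) ≡ + t ℤ.+ ballColumn i₀ r k
ballColumn-+ i₀ r t k = rearrange i₀ (+ t) (+ k) (+ r)
  where
  rearrange : ∀ i t k r → i ℤ.+ (t ℤ.+ k) ℤ.- r ≡ t ℤ.+ (i ℤ.+ k ℤ.- r)
  rearrange = ℤ-Solver.solve-∀

windowWeight-ballColumn : ∀ S i₀ r k → windowWeight S (ballColumn i₀ r k) ≡ Σ₃ (columnWeight S ∘ ballColumn i₀ r) k
windowWeight-ballColumn S i₀ r k =
  cong₂ _+_ (cong₂ _+_ (cong (columnWeight S) (sym (ballColumn-+ i₀ r 0 k)))
                       (cong (columnWeight S) (sym (ballColumn-+ i₀ r 1 k))))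
            (cong (columnWeight S) (sym (ballColumn-+ i₀ r 2 k)))

withinBall : Vertex → ℕ → List Vertex → List Vertex
withinBall v r = filter (λ w → dist v w ≤? r)

count-ball : ∀ S b₀ i₀ r →
  count S (ball (b₀ , i₀) r) ≡ ∑< (suc (r + r)) (count S ∘ withinBall (b₀ , i₀) r ∘ column ∘ ballColumn i₀ r)
count-ball S b₀ i₀ r =
  count-filter-concatMap S (λ w → dist (b₀ , i₀) w ≤? r) (column ∘ ballColumn i₀ r) id (suc (r + r))

count-ball-≤ : ∀ S b₀ i₀ r → count S (ball (b₀ , i₀) r) ≤ ∑< (suc (r + r)) (columnWeight S ∘ ballColumn i₀ r)
count-ball-≤ S b₀ i₀ r = ≤-trans (≤-reflexive (count-ball S b₀ i₀ r))
  (∑<-mono-≤ (suc (r + r)) (λ k _ → count-filter-≤ S (λ w → dist (b₀ , i₀) w ≤? r) (column (ballColumn i₀ r k))))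

∣⊖∣≤ : ∀ m n → n ≤ m + m → ∣ m ⊖ n ∣ ≤ m
∣⊖∣≤ m n n≤2m with ≤-total n m
... | inj₁ n≤m = subst (_≤ m) (sym (cong ∣_∣ (ℤ.⊖-≥ n≤m))) (m∸n≤m m n)
... | inj₂ m≤n = subst (_≤ m) (sym (trans (ℤ.∣m⊖n∣≡∣n⊖m∣ m n) (cong ∣_∣ (ℤ.⊖-≥ m≤n)))) (m≤n+o⇒m∸n≤o n m n≤2m)

middleColumn-within : ∀ b₀ i₀ r t → t ≤ r + r → ∀ b → dist (b₀ , i₀) (b , ballColumn i₀ (suc r) (suc t)) ≤ suc r
middleColumn-within b₀ i₀ r t t≤2r b = begin
  ∣ i₀ ℤ.- ballColumn i₀ (suc r) (suc t) ∣ + δ ≡⟨ cong (λ z → ∣ z ∣ + δ) (offset i₀ (+ suc t) (+ suc r)) ⟩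
  ∣ suc r ⊖ suc t ∣ + δ                        ≡⟨ cong (λ z → ∣ z ∣ + δ) (ℤ.[1+m]⊖[1+n]≡m⊖n r t) ⟩
  ∣ r ⊖ t ∣ + δ                                ≤⟨ +-mono-≤ (∣⊖∣≤ r t t≤2r) (side-change (does (b₀ ≟ᵇ b))) ⟩
  r + 1                                        ≡⟨ +-comm r 1 ⟩
  suc r ∎
  where
  open ≤-Reasoning
  δ = if does (b₀ ≟ᵇ b) then 0 else 1
  offset : ∀ i t r → i ℤ.- (i ℤ.+ t ℤ.- r) ≡ r ℤ.- t
  offset = ℤ-Solver.solve-∀
  side-change : ∀ x → (if x then 0 else 1) ≤ 1
  side-change true = z≤n
  side-change false = ≤-refl

count-ball-≥ : ∀ S b₀ i₀ r →
  ∑< (suc (r + r)) (columnWeight S ∘ ballColumn i₀ (suc r) ∘ suc) ≤ count S (ball (b₀ , i₀) (suc r))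
count-ball-≥ S b₀ i₀ r = begin
  ∑< (suc (r + r)) (columnWeight S ∘ ballColumn i₀ (suc r) ∘ suc)
    ≤⟨ ∑<-mono-≤ (suc (r + r)) (λ t t≤2r → ≤-reflexive (cong (count S) (sym (middleColumn-inside t (≤-pred t≤2r))))) ⟩
  ∑< (suc (r + r)) (h ∘ suc)        ≤⟨ ∑<-monoˡ-≤ (h ∘ suc) (s≤s (+-monoʳ-≤ r (n≤1+n r))) ⟩
  ∑< (suc r + suc r) (h ∘ suc)      ≤⟨ m≤n+m _ (h 0) ⟩
  ∑< (suc (suc r + suc r)) h        ≡⟨ count-ball S b₀ i₀ (suc r) ⟨
  count S (ball (b₀ , i₀) (suc r)) ∎
  where
  open ≤-Reasoning
  h = count S ∘ withinBall (b₀ , i₀) (suc r) ∘ column ∘ ballColumn i₀ (suc r)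
  middleColumn-inside : ∀ t → t ≤ r + r →
    withinBall (b₀ , i₀) (suc r) (column (ballColumn i₀ (suc r) (suc t))) ≡ column (ballColumn i₀ (suc r) (suc t))
  middleColumn-inside t t≤2r = filter-all (λ w → dist (b₀ , i₀) w ≤? suc r)
    (middleColumn-within b₀ i₀ r t t≤2r false ∷ middleColumn-within b₀ i₀ r t t≤2r true ∷ [])

ballSize-≤ : ∀ v r → ballSize v r ≤ suc (r + r) * 2
ballSize-≤ (b₀ , i₀) r = begin
  ballSize (b₀ , i₀) r                   ≡⟨ length≡count-all (ball (b₀ , i₀) r) ⟩
  count (λ _ → true) (ball (b₀ , i₀) r)  ≤⟨ count-ball-≤ (λ _ → true) b₀ i₀ r ⟩
  ∑< (suc (r + r)) (λ _ → 2)             ≡⟨ ∑<-const (suc (r + r)) 2 ⟩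
  suc (r + r) * 2 ∎
  where open ≤-Reasoning

ballSize-≥ : ∀ v r → suc (r + r) * 2 ≤ ballSize v (suc r)
ballSize-≥ (b₀ , i₀) r = begin
  suc (r + r) * 2                             ≡⟨ ∑<-const (suc (r + r)) 2 ⟨
  ∑< (suc (r + r)) (λ _ → 2)                  ≤⟨ count-ball-≥ (λ _ → true) b₀ i₀ r ⟩
  count (λ _ → true) (ball (b₀ , i₀) (suc r)) ≡⟨ length≡count-all (ball (b₀ , i₀) (suc r)) ⟨
  ballSize (b₀ , i₀) (suc r) ∎
  where open ≤-Reasoning

radius≤ballSize : ∀ v r → r ≤ ballSize v (suc r)
radius≤ballSize v r =
  ≤-trans (≤-trans (m≤m+n r r) (≤-trans (n≤1+n (r + r)) (m≤m*n (suc (r + r)) 2))) (ballSize-≥ v r)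

IsREDIC-ball-estimate : ∀ S → IsREDIC S → ∀ v r → 2 * ballSize v (suc r) ≤ 3 * count S (ball v (suc r)) + 16
IsREDIC-ball-estimate S redic v@(b₀ , i₀) r = begin
  2 * ballSize v (suc r)                 ≤⟨ *-monoʳ-≤ 2 (ballSize-≤ v (suc r)) ⟩
  2 * (suc (suc r + suc r) * 2)          ≡⟨ arithmetic r ⟩
  suc (r + r) * 4 + 8                    ≤⟨ +-monoˡ-≤ 8 (∑<-Σ₃-lower f heavy (suc (r + r))) ⟩
  3 * ∑< (suc (r + r)) f + 2 * 4 + 8     ≤⟨ +-monoˡ-≤ 8 (+-monoˡ-≤ 8 (*-monoʳ-≤ 3 (count-ball-≥ S b₀ i₀ r))) ⟩
  3 * count S (ball v (suc r)) + 8 + 8   ≡⟨ +-assoc (3 * count S (ball v (suc r))) 8 8 ⟩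
  3 * count S (ball v (suc r)) + 16 ∎
  where
  open ≤-Reasoning
  f = columnWeight S ∘ ballColumn i₀ (suc r) ∘ suc
  heavy : ∀ k → 4 ≤ Σ₃ f k
  heavy k = subst (4 ≤_) (windowWeight-ballColumn S i₀ (suc r) (suc k))
                  (IsREDIC-windowWeight S redic (ballColumn i₀ (suc r) (suc k)))
  arithmetic : ∀ r → 2 * (suc (suc r + suc r) * 2) ≡ suc (r + r) * 4 + 8
  arithmetic = ℕ-Solver.solve-∀

ladderCode-ball-estimate : ∀ v r → 3 * count ladderCode (ball v (suc r)) ≤ 2 * ballSize v (suc r) + 16
ladderCode-ball-estimate v@(b₀ , i₀) r = begin
  3 * count ladderCode (ball v (suc r))  ≤⟨ *-monoʳ-≤ 3 (count-ball-≤ ladderCode b₀ i₀ (suc r)) ⟩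
  3 * ∑< (suc (suc r + suc r)) f         ≤⟨ ∑<-Σ₃-upper f light (suc (suc r + suc r)) ⟩
  suc (suc r + suc r) * 4 + 2 * 4        ≡⟨ arithmetic r ⟩
  2 * (suc (r + r) * 2) + 16             ≤⟨ +-monoˡ-≤ 16 (*-monoʳ-≤ 2 (ballSize-≥ v r)) ⟩
  2 * ballSize v (suc r) + 16 ∎
  where
  open ≤-Reasoning
  f = columnWeight ladderCode ∘ ballColumn i₀ (suc r)
  light : ∀ k → Σ₃ f k ≤ 4
  light k = ≤-reflexive (trans (sym (windowWeight-ballColumn ladderCode i₀ (suc r) k))
                               (ladderCode-windowWeight (ballColumn i₀ (suc r) k)))
  arithmetic : ∀ r → suc (suc r + suc r) * 4 + 2 * 4 ≡ 2 * (suc (r + r) * 2) + 16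
  arithmetic = ℕ-Solver.solve-∀

-- From linear estimates to rational densities

private
  pos-*-* : ∀ a b c → + (a * (b * c)) ≡ + a ℤ.* (+ b ℤ.* + c)
  pos-*-* a b c = trans (ℤ.pos-* a (b * c)) (cong (+ a ℤ.*_) (ℤ.pos-* b c))

  toℚᵘ-scaled : ∀ q N → toℚᵘ ((+ 2 / 3 ℚ.+ q) ℚ.* (+ N / 1)) ℚᵘ.≃ (mkℚᵘ (+ 2) 2 ℚᵘ.+ toℚᵘ q) ℚᵘ.* mkℚᵘ (+ N) 0
  toℚᵘ-scaled q N = ℚᵘ.≃-trans (ℚ.toℚᵘ-homo-* (+ 2 / 3 ℚ.+ q) (+ N / 1))
                      (ℚᵘ.*-cong (ℚ.toℚᵘ-homo-+ (+ 2 / 3) q) (ℚ.toℚᵘ-fromℚᵘ (mkℚᵘ (+ N) 0)))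

  toℚᵘ-natural : ∀ C → toℚᵘ (+ C / 1) ℚᵘ.≃ mkℚᵘ (+ C) 0
  toℚᵘ-natural C = ℚ.toℚᵘ-fromℚᵘ (mkℚᵘ (+ C) 0)

  ratio-above-ℕ : ∀ {c C N} D p .{{_ : ℕ.NonZero p}} → suc (c * D) ≤ N → 2 * N ≤ 3 * C + c →
                  D * (2 * N) < D * (3 * C) + N * (3 * p)
  ratio-above-ℕ {c} {C} {N} D p cD<N 2N≤3C+c = begin-strict
    D * (2 * N)               ≤⟨ *-monoʳ-≤ D 2N≤3C+c ⟩
    D * (3 * C + c)           ≡⟨ *-distribˡ-+ D (3 * C) c ⟩
    D * (3 * C) + D * c       ≡⟨ cong (D * (3 * C) ℕ.+_) (*-comm D c) ⟩
    D * (3 * C) + c * D       <⟨ +-monoʳ-< (D * (3 * C)) cD<N ⟩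
    D * (3 * C) + N           ≤⟨ +-monoʳ-≤ (D * (3 * C)) (m≤m*n N (3 * p) {{m*n≢0 3 p}}) ⟩
    D * (3 * C) + N * (3 * p) ∎
    where open ≤-Reasoning

  ratio-below-ℕ : ∀ {c C N} D p .{{_ : ℕ.NonZero p}} → c * D ≤ N → 3 * C ≤ 2 * N + c →
                  D * (3 * C) ≤ D * (2 * N) + N * (3 * p)
  ratio-below-ℕ {c} {C} {N} D p cD≤N 3C≤2N+c = begin
    D * (3 * C)               ≤⟨ *-monoʳ-≤ D 3C≤2N+c ⟩
    D * (2 * N + c)           ≡⟨ *-distribˡ-+ D (2 * N) c ⟩
    D * (2 * N) + D * c       ≡⟨ cong (D * (2 * N) ℕ.+_) (*-comm D c) ⟩
    D * (2 * N) + c * D       ≤⟨ +-monoʳ-≤ (D * (2 * N)) cD≤N ⟩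
    D * (2 * N) + N           ≤⟨ +-monoʳ-≤ (D * (2 * N)) (m≤m*n N (3 * p) {{m*n≢0 3 p}}) ⟩
    D * (2 * N) + N * (3 * p) ∎
    where open ≤-Reasoning

-- With ε = (k+1)/(d+1), clearing denominators turns the two claims below
-- into ratio-above-ℕ and ratio-below-ℕ for D = d+1 and p = k+1.
ratio-above-2/3-ε : ∀ c ε → 0ℚ ℚ.< ε → ∃[ K ] ∀ C N → K ≤ N → 2 * N ≤ 3 * C + c →
                    (+ 2 / 3 ℚ.- ε) ℚ.* (+ N / 1) ℚ.< + C / 1
ratio-above-2/3-ε c ε@(mkℚ (+ suc k) d _) _ = suc (c * suc d) , λ C N cD<N 2N≤3C+c →
  ℚ.toℚᵘ-cancel-< (ℚᵘ.<-respʳ-≃ (ℚᵘ.≃-sym (toℚᵘ-natural C)) (ℚᵘ.<-respˡ-≃ (ℚᵘ.≃-sym (toℚᵘ-scaled (ℚ.- ε) N))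
    (*<* (subst₂ ℤ._<_ (lhs (+ suc d) (+ suc k) (+ N)) (rhs (+ suc d) (+ suc k) (+ C) (+ N))
      (ℤ.+-monoˡ-< (- (+ N ℤ.* (+ 3 ℤ.* + suc k)))
        (subst₂ ℤ._<_ (pos-*-* (suc d) 2 N) (cong₂ ℤ._+_ (pos-*-* (suc d) 3 C) (pos-*-* N 3 (suc k)))
          (ℤ.+<+ (ratio-above-ℕ {c} {C} {N} (suc d) (suc k) cD<N 2N≤3C+c))))))))
  where
  lhs : ∀ D p N → D ℤ.* (+ 2 ℤ.* N) ℤ.- N ℤ.* (+ 3 ℤ.* p) ≡ ((+ 2 ℤ.* D ℤ.+ - p ℤ.* + 3) ℤ.* N) ℤ.* + 1
  lhs = ℤ-Solver.solve-∀
  rhs : ∀ D p C N → D ℤ.* (+ 3 ℤ.* C) ℤ.+ N ℤ.* (+ 3 ℤ.* p) ℤ.- N ℤ.* (+ 3 ℤ.* p) ≡ C ℤ.* (+ 3 ℤ.* D ℤ.* + 1)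
  rhs = ℤ-Solver.solve-∀
ratio-above-2/3-ε c (mkℚ (+ zero) _ _) (ℚ.*<* (ℤ.+<+ ()))
ratio-above-2/3-ε c (mkℚ -[1+ _ ] _ _) (ℚ.*<* ())

ratio-below-2/3+ε : ∀ c ε → 0ℚ ℚ.< ε → ∃[ K ] ∀ C N → K ≤ N → 3 * C ≤ 2 * N + c →
                    + C / 1 ℚ.≤ (+ 2 / 3 ℚ.+ ε) ℚ.* (+ N / 1)
ratio-below-2/3+ε c ε@(mkℚ (+ suc k) d _) _ = c * suc d , λ C N cD≤N 3C≤2N+c →
  ℚ.toℚᵘ-cancel-≤ (ℚᵘ.≤-respʳ-≃ (ℚᵘ.≃-sym (toℚᵘ-scaled ε N)) (ℚᵘ.≤-respˡ-≃ (ℚᵘ.≃-sym (toℚᵘ-natural C))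
    (*≤* (subst₂ ℤ._≤_ (trans (pos-*-* (suc d) 3 C) (lhs (+ suc d) (+ C)))
                       (trans (cong₂ ℤ._+_ (pos-*-* (suc d) 2 N) (pos-*-* N 3 (suc k))) (rhs (+ suc d) (+ suc k) (+ N)))
      (ℤ.+≤+ (ratio-below-ℕ {c} {C} {N} (suc d) (suc k) cD≤N 3C≤2N+c))))))
  where
  lhs : ∀ D C → D ℤ.* (+ 3 ℤ.* C) ≡ C ℤ.* (+ 3 ℤ.* D ℤ.* + 1)
  lhs = ℤ-Solver.solve-∀
  rhs : ∀ D p N → D ℤ.* (+ 2 ℤ.* N) ℤ.+ N ℤ.* (+ 3 ℤ.* p) ≡ ((+ 2 ℤ.* D ℤ.+ p ℤ.* + 3) ℤ.* N) ℤ.* + 1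
  rhs = ℤ-Solver.solve-∀
ratio-below-2/3+ε c (mkℚ (+ zero) _ _) (ℚ.*<* (ℤ.+<+ ()))
ratio-below-2/3+ε c (mkℚ -[1+ _ ] _ _) (ℚ.*<* ())

*-natural-monoˡ-≤ : ∀ N {p q} → p ℚ.≤ q → p ℚ.* (+ N / 1) ℚ.≤ q ℚ.* (+ N / 1)
*-natural-monoˡ-≤ N = ℚ.*-monoʳ-≤-nonNeg (+ N / 1) {{ℚ.normalize-nonNeg N 1}}

-- Explicit implicits: inferring them would normalise gcd (ballSize v r) 1.
DensityLE-mono : ∀ {S v c c′} → c ℚ.≤ c′ → DensityLE S v c → DensityLE S v c′
DensityLE-mono {S} {v} {c} {c′} c≤c′ density ε ε>0 =
  proj₁ (density ε ε>0) , λ r R≤r → ℚ.≤-trans {+ count S (ball v r) / 1} {(c ℚ.+ ε) ℚ.* (+ ballSize v r / 1)}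
    (proj₂ (density ε ε>0) r R≤r) (*-natural-monoˡ-≤ (ballSize v r) (ℚ.+-monoˡ-≤ ε c≤c′))

theorem8 : ∀ v₀ → REDICdensityIs v₀ (+ 2 / 3)
theorem8 v₀ = lower , upper
  where
  lower : ∀ S → IsREDIC S → DensityGE S v₀ (+ 2 / 3)
  lower S redic ε ε>0 R = r , ≤-trans (m≤m+n R K) (n≤1+n (R + K)) ,
    proj₂ (ratio-above-2/3-ε 16 ε ε>0) (count S (ball v₀ r)) (ballSize v₀ r)
      (≤-trans (m≤n+m K R) (radius≤ballSize v₀ (R + K))) (IsREDIC-ball-estimate S redic v₀ (R + K))
    where
    K = proj₁ (ratio-above-2/3-ε 16 ε ε>0)
    r = suc (R + K)

  ladderCode-density : DensityLE ladderCode v₀ (+ 2 / 3)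
  ladderCode-density ε ε>0 = suc (proj₁ (ratio-below-2/3+ε 16 ε ε>0)) , λ { (suc r) (s≤s K≤r) →
    proj₂ (ratio-below-2/3+ε 16 ε ε>0) (count ladderCode (ball v₀ (suc r))) (ballSize v₀ (suc r))
      (≤-trans K≤r (radius≤ballSize v₀ r)) (ladderCode-ball-estimate v₀ r) }

  upper : ∀ ε → 0ℚ ℚ.< ε → ∃[ S ] (IsREDIC S × DensityLE S v₀ (+ 2 / 3 ℚ.+ ε))
  upper ε ε>0 = ladderCode , ladderCode-IsREDIC , DensityLE-mono {ladderCode} {v₀} 2/3≤2/3+ε ladderCode-density
    where
    2/3≤2/3+ε : + 2 / 3 ℚ.≤ + 2 / 3 ℚ.+ ε
    2/3≤2/3+ε = ℚ.≤-trans (ℚ.≤-reflexive (sym (ℚ.+-identityʳ (+ 2 / 3)))) (ℚ.+-monoʳ-≤ (+ 2 / 3) (ℚ.<⇒≤ ε>0))
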